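{- Let $k$ be a positive integer with $k \equiv 1 \pmod 5$ and let \[ n = L_{CC}(10,k) = \frac{512k^5+1280k^4+6560k^3+9520k^2+6100k+1028}{3125}. \] Then there is an undirected Cayley graph of the cyclic group $\mathbb{Z}_n$ on five generators which has diameter $k$. Moreover, a generating set for such a graph is \[ \Big\{1,\ \tfrac{128k^4+448k^3+1688k^2+3768k+843}{625},\ \tfrac{256k^4+416k^3+2816k^2+2346k+416}{625},\ \tfrac{256k^4+576k^3+3136k^2+3976k+1431}{625},\ \tfrac{384k^4+864k^3+4504k^2+5614k+1134}{625}\Big\}, \] i.e. the Cayley graph of $\mathbb{Z}_n$ with connection set $\{\pm g_1,\dots,\pm g_5\}$, where $g_1,\dots,g_5$ are these integers taken modulo $n$, has diameter $k$.
   Context: For a positive integer $n$ and integers $g_1,\dots,g_5$, the undirected Cayley (circulant) graph of the cyclic group $\mathbb{Z}_n$ with generating set $\{g_1,\dots,g_5\}$ has vertex set $\mathbb{Z}_n$, with $i$ and $j$ adjacent if and only if $j-i \equiv \pm g_t \pmod n$ for some $t$. Its diameter is the maximum over pairs of vertices of the graph distance. The notation $L_{CC}(10,k)$ is just a name for the displayed polynomial value. -}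

module Defs where

open import Data.Nat as ℕ using (ℕ; suc; _≤_; _<_; _%_; _/_; _+_; _*_; _^_)
open import Data.Integer as ℤ using (ℤ; +_; -_)
open import Data.Integer.Divisibility using () renaming (_∣_ to _∣ℤ_)
open import Data.List using (List; []; _∷_; length; foldr)
open import Data.List.Relation.Unary.All using (All)
open import Data.List.Membership.Propositional using (_∈_)
open import Data.Fin using (Fin; toℕ)
open import Data.Product using (Σ; _×_; ∃; ∃₂)
open import Data.Sum using (_⊎_)
open import Relation.Binary.PropositionalEquality using (_≡_)
open import Relation.Nullary using (¬_)

sumℤ : List ℤ → ℤ
sumℤ = foldr ℤ._+_ (+ 0)

-- s is an element of the connection set {±g_t} (as integers; reduced mod n implicitly
-- because walks are only compared modulo n below).
IsStep : List ℤ → ℤ → Set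
IsStep gens s = Σ ℤ λ g → (g ∈ gens) × ((s ≡ g) ⊎ (s ≡ - g))

Walk : (n : ℕ) → List ℤ → Fin n → Fin n → ℕ → Set
Walk n gens i j ℓ =
  Σ (List ℤ) λ steps →
    (length steps ≡ ℓ) × All (IsStep gens) steps ×
    ((+ n) ∣ℤ ((+ toℕ j) ℤ.- (+ toℕ i) ℤ.- sumℤ steps))

DistLe : (n : ℕ) → List ℤ → Fin n → Fin n → ℕ → Set
DistLe n gens i j d = Σ ℕ λ ℓ → (ℓ ≤ d) × Walk n gens i j ℓ

-- The diameter (maximum over all pairs of the graph distance) equals D:
-- every pair is at distance ≤ D, and some pair is not at distance ≤ D - 1
-- (i.e. at distance ≥ D, possibly ∞ if disconnected -- excluded by the first clause).
HasDiameter : (n : ℕ) → List ℤ → ℕ → Set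
HasDiameter n gens D =
  ((i j : Fin n) → DistLe n gens i j D) ×
  (Σ (Fin n) λ i → Σ (Fin n) λ j → (ℓ : ℕ) → ℓ < D → ¬ Walk n gens i j ℓ)

Lcc10 : ℕ → ℕ
Lcc10 k = (512 * k ^ 5 + 1280 * k ^ 4 + 6560 * k ^ 3 + 9520 * k ^ 2 + 6100 * k + 1028) / 3125

g₂ g₃ g₄ g₅ : ℕ → ℕ
g₂ k = (128 * k ^ 4 + 448 * k ^ 3 + 1688 * k ^ 2 + 3768 * k + 843) / 625
g₃ k = (256 * k ^ 4 + 416 * k ^ 3 + 2816 * k ^ 2 + 2346 * k + 416) / 625
g₄ k = (256 * k ^ 4 + 576 * k ^ 3 + 3136 * k ^ 2 + 3976 * k + 1431) / 625
g₅ k = (384 * k ^ 4 + 864 * k ^ 3 + 4504 * k ^ 2 + 5614 * k + 1134) / 625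

gens10 : ℕ → List ℤ
gens10 k = + 1 ∷ + g₂ k ∷ + g₃ k ∷ + g₄ k ∷ + g₅ k ∷ []

{-# OPTIONS --safe #-}
-- For k = 1 the graph is complete on 8 vertices. Otherwise write k = 5m + 1 with m ≥ 1 and
-- a = 2m. The relations between the five generators form the lattice
-- L of index n in ℤ⁵ spanned by the rows u₁, …, u₅ of U = 2a I + B and by half their sum,
-- where the off-diagonal part of B is skew-symmetric with entries 0, ±1. The diameter is the
-- largest ℓ₁-distance from a point of ℤ⁵ to L.
--
-- For a sign vector s the point h(s) = ½ s U lies in L, and skewness gives it norm
-- 5a + 3 = 2k + 1, so every x in the box spanned by 0 and h(s) satisfies
-- ∣x∣ + ∣x - h(s)∣ = 2k + 1, and one of the two norms is at most k. If x has no zero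
-- coordinate and no u_i decreases the norm of x, then the inequalities ∣x ∓ u_i∣ ≥ ∣x∣ say, again
-- by skewness, exactly that x lies in the box of its own signs. If x has zero coordinates, their
-- signs can be chosen so that x lies in a box unless a sum of at most three ±u_i decreases
-- the norm; this depends only on the signs of x and on the few coordinates close to a, and is
-- settled by a finite computation with a left symbolic.
--
-- Conversely (m, m + 1, m, m, m) has distance k from L: estimate ∣x - ½ c U∣ from below by
-- pairing with the signs of c, the entries of c being either all even or all odd.

module Submission where

open import Defs
open import Data.Nat as ℕ using (ℕ; zero; suc; NonZero; _≤_; _<_; _%_; z≤n; s≤s)
open import Relation.Binary.PropositionalEquality using (_≡_; refl; sym; trans; cong; cong₂; subst; subst₂; module ≡-Reasoning)

open import Data.Bool using (Bool; true; false)
open import Data.Empty using (⊥; ⊥-elim)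
open import Data.Fin using (Fin; toℕ; fromℕ<; #_)
open import Data.Fin.Properties using (toℕ-fromℕ<; all?)
open import Data.Integer using (ℤ; +_; -[1+_]; -_; _+_; _*_; _-_; _⊔_; ∣_∣; 0ℤ; 1ℤ; -1ℤ; +≤+; -≤+; drop‿+≤+; _≤?_; _≟_) renaming (_≤_ to _≤ᶻ_)
open import Data.Integer.Divisibility using () renaming (_∣_ to _∣ℤ_)
open import Data.Integer.Divisibility.Signed using (divides; ∣ᵤ⇒∣; ∣⇒∣ᵤ)
open import Data.Integer.DivMod using (_/ℕ_; _%ℕ_; n%ℕd<d; a≡a%ℕn+[a/ℕn]*n)
import Data.Integer.Properties as ℤₚ
open import Data.Integer.Solver using (module +-*-Solver)
open import Data.List as List using (List; []; _∷_)
open import Data.List.Relation.Unary.All as All using (All; []; _∷_)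
open import Data.List.Relation.Unary.Any as Any using (Any; here; there)
import Data.Nat.Properties as ℕₚ
open import Data.Nat.Tactic.RingSolver using () renaming (solve-∀ to ℕ-ring)
open import Data.Nat.Divisibility using (_∣?_)
open import Data.Nat.DivMod using (m*n/n≡m; m≡m%n+[m/n]*n)
open import Data.Nat.Induction using (<-wellFounded)
open import Induction.WellFounded using (Acc; acc)
open import Data.Product using (∃; ∃₂; _×_; _,_; proj₁; proj₂)
open import Data.Sign using (Sign) renaming (+ to ⊕; - to ⊖)
import Data.Sign.Properties as Sign
open import Data.Sum using (_⊎_; inj₁; inj₂; [_,_]′)
open import Data.Unit using (⊤; tt)
open import Data.Vec as Vec using (Vec; []; _∷_; zipWith; map; replicate; head; tail)
open import Data.Vec.Relation.Binary.Pointwise.Inductive as Pointwise using (Pointwise; []; _∷_)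
open import Function using (id; _∘_)
open import Relation.Nullary using (Dec; yes; no; does; ¬_)
open import Relation.Nullary.Decidable using (_×-dec_; _⊎-dec_; from-no)
open +-*-Solver using (Polynomial; solve; con; _:=_; _:+_; _:*_; _:-_; :-_)

-- Signs and absolute values

sgn : Sign → ℤ → ℤ
sgn ⊕ x = x
sgn ⊖ x = - x

≤-from : ∀ {i j k l} → i ≤ᶻ j → j - i ≡ l - k → k ≤ᶻ l
≤-from i≤j eq = ℤₚ.0≤i-j⇒j≤i (subst (0ℤ ≤ᶻ_) eq (ℤₚ.i≤j⇒0≤j-i i≤j))

-- For x ≥ 0 the difference ∣x - v∣ - ∣x∣ equals -v if v ≤ x and v - 2x otherwise, so `d` has to
-- bound both.
∣x-v∣≤∣x∣+d : ∀ x v d → 0ℤ ≤ᶻ x → - v ≤ᶻ d → v - (x + x) ≤ᶻ d → + ∣ x - v ∣ ≤ᶻ + ∣ x ∣ + d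
∣x-v∣≤∣x∣+d x v d 0≤x -v≤d v-2x≤d with ℤₚ.≤-total v x
... | inj₁ v≤x = subst₂ _≤ᶻ_ (sym (ℤₚ.0≤i⇒+∣i∣≡i (ℤₚ.i≤j⇒0≤j-i v≤x))) (cong (_+ d) (sym (ℤₚ.0≤i⇒+∣i∣≡i 0≤x)))
        (≤-from -v≤d (solve 3 (λ x v d → d :- (:- v) := (x :+ d) :- (x :- v)) refl x v d))
... | inj₂ x≤v = subst₂ _≤ᶻ_ (sym (trans (cong +_ (ℤₚ.∣i-j∣≡∣j-i∣ x v)) (ℤₚ.0≤i⇒+∣i∣≡i (ℤₚ.i≤j⇒0≤j-i x≤v)))) (cong (_+ d) (sym (ℤₚ.0≤i⇒+∣i∣≡i 0≤x)))
        (≤-from v-2x≤d (solve 3 (λ x v d → d :- (v :- (x :+ x)) := (x :+ d) :- (v :- x)) refl x v d))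

∣x-v∣+∣x∣≡v : ∀ x v → 0ℤ ≤ᶻ x → x ≤ᶻ v → + ∣ x - v ∣ + + ∣ x ∣ ≡ v
∣x-v∣+∣x∣≡v x v 0≤x x≤v = trans
  (cong₂ _+_ (trans (cong +_ (ℤₚ.∣i-j∣≡∣j-i∣ x v)) (ℤₚ.0≤i⇒+∣i∣≡i (ℤₚ.i≤j⇒0≤j-i x≤v))) (ℤₚ.0≤i⇒+∣i∣≡i 0≤x))
  (solve 2 (λ x v → (v :- x) :+ x := v) refl x v)

∣sgn∣ : ∀ s x → ∣ sgn s x ∣ ≡ ∣ x ∣
∣sgn∣ ⊕ x = refl
∣sgn∣ ⊖ x = ℤₚ.∣-i∣≡∣i∣ x

∣sgn-sgn∣ : ∀ s x v → ∣ sgn s x - sgn s v ∣ ≡ ∣ x - v ∣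
∣sgn-sgn∣ ⊕ x v = refl
∣sgn-sgn∣ ⊖ x v = trans (cong ∣_∣ (solve 2 (λ x v → :- x :- :- v := :- (x :- v)) refl x v)) (ℤₚ.∣-i∣≡∣i∣ (x - v))

∣x-v∣≤∣x∣+d-signed : ∀ s {x v d} → 0ℤ ≤ᶻ sgn s x → - sgn s v ≤ᶻ d →
  sgn s v - (sgn s x + sgn s x) ≤ᶻ d → + ∣ x - v ∣ ≤ᶻ + ∣ x ∣ + d
∣x-v∣≤∣x∣+d-signed s {x} {v} {d} p q r =
  subst₂ (λ i j → + i ≤ᶻ + j + d) (∣sgn-sgn∣ s x v) (∣sgn∣ s x)
    (∣x-v∣≤∣x∣+d (sgn s x) (sgn s v) d p q r)

sgn≤∣∣ : ∀ s x → sgn s x ≤ᶻ + ∣ x ∣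
sgn≤∣∣ s x = subst (λ n → sgn s x ≤ᶻ + n) (∣sgn∣ s x) (i≤∣i∣ (sgn s x))
  where
  i≤∣i∣ : ∀ i → i ≤ᶻ + ∣ i ∣
  i≤∣i∣ (+ n) = ℤₚ.≤-refl
  i≤∣i∣ -[1+ n ] = -≤+

-- Norms and the lattice

norm : ∀ {n} → Vec ℤ n → ℕ
norm [] = 0
norm (x ∷ xs) = ∣ x ∣ ℕ.+ norm xs

_⊝_ : ∀ {n} → Vec ℤ n → Vec ℤ n → Vec ℤ n
_⊝_ = zipWith _-_

signedSum : ∀ {n} → Vec Sign n → Vec ℤ n → ℤ
signedSum [] [] = 0ℤ
signedSum (s ∷ ss) (q ∷ qs) = sgn s q + signedSum ss qs

-- The trace is 6, so skewness gives ½ s B s = 3 for every sign vector s: the 3 in the norm 5a + 3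
-- of h(s).
B : Vec (Vec ℤ 5) 5
B = (1ℤ ∷ -1ℤ ∷ -1ℤ ∷ 0ℤ ∷ 1ℤ ∷ [])
  ∷ (1ℤ ∷ + 2 ∷ 0ℤ ∷ -1ℤ ∷ 0ℤ ∷ [])
  ∷ (1ℤ ∷ 0ℤ ∷ 1ℤ ∷ -1ℤ ∷ 1ℤ ∷ [])
  ∷ (0ℤ ∷ 1ℤ ∷ 1ℤ ∷ 1ℤ ∷ -1ℤ ∷ [])
  ∷ (-1ℤ ∷ 0ℤ ∷ -1ℤ ∷ 1ℤ ∷ 1ℤ ∷ [])
  ∷ []

-- Half the sum of the rows of B.
halfSum : Vec ℤ 5
halfSum = 1ℤ ∷ 1ℤ ∷ 0ℤ ∷ 0ℤ ∷ 1ℤ ∷ []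

-- Generic in the scalars, so that the ring solver can run the same code on polynomials.
module Linear {A : Set} (ι : ℤ → A) (_⊞_ _⊠_ : A → A → A) where

  dot : ∀ {n} → Vec A n → Vec A n → A
  dot [] [] = ι 0ℤ
  dot (x ∷ xs) (y ∷ ys) = (x ⊠ y) ⊞ dot xs ys

  combine : ∀ {n d} → Vec A n → Vec (Vec ℤ d) n → Vec A d
  combine [] [] = replicate _ (ι 0ℤ)
  combine (c ∷ cs) (r ∷ rs) = zipWith _⊞_ (map (λ x → c ⊠ ι x) r) (combine cs rs)

  offset : A → Vec A 5 → Vec A 5
  offset c e = zipWith _⊞_ (map (λ x → c ⊠ ι x) halfSum) (combine e B)

  entry : A → A → A → A → A
  entry a c z q = (a ⊠ (c ⊞ (z ⊞ z))) ⊞ q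

  -- c h + e U, where U = 2 a I + B and h is half the sum of the rows of U.
  point : A → A → Vec A 5 → Vec A 5
  point a c e = zipWith (entry a c) e (offset c e)

  eval : List ℤ → A → A
  eval [] a = ι 0ℤ
  eval (c ∷ cs) a = ι c ⊞ (a ⊠ eval cs a)

open Linear id _+_ _*_
module Formal {n} = Linear {Polynomial n} con _:+_ _:*_

-- Cells, descending moves and boxes

data Cell : Set where
  zero           : Cell
  below at above : Sign → ℤ → Cell

-- The levels t are constants: cells locate a coordinate relative to the indeterminate a.
_⊢_∈_ : ℤ → ℤ → Cell → Set
a ⊢ x ∈ zero      = x ≡ 0ℤ
a ⊢ x ∈ below s t = 1ℤ ≤ᶻ sgn s x × sgn s x ≤ᶻ a + t
a ⊢ x ∈ at s t    = 1ℤ ≤ᶻ sgn s x × sgn s x ≡ a + t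
a ⊢ x ∈ above s t = 1ℤ ≤ᶻ sgn s x × a + t ≤ᶻ sgn s x

-- A vector of Booleans selects the rows of U to be subtracted, each with the sign of x.
coeff : Bool → Cell → ℤ
coeff true (at s t)    = sgn s 1ℤ
coeff true (above s t) = sgn s 1ℤ
coeff _    _           = 0ℤ

-- Both bounds come from the maximum of -v and v - 2x, after signing. In `stay`, v = q and x ≥ 1; in
-- `cross`, v = 2a + q with a ≥ 2 and x ≥ a + t, so that a cancels from v - 2x.
stay : Sign → ℤ → ℤ
stay s q = (- sgn s q) ⊔ (sgn s q - + 2)

cross : Sign → ℤ → ℤ → ℤ
cross s t q = (- (+ 4 + sgn s q)) ⊔ (sgn s q - (t + t))

-- Upper bounds for ∣ x - v ∣ - ∣ x ∣, valid for all a ≥ 2, where v = entry a 0ℤ (coeff b c) q.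
change : Bool → Cell → ℤ → ℤ
change _     zero        q = (- q) ⊔ q
change _     (below s t) q = stay s q
change false (at s t)    q = stay s q
change false (above s t) q = stay s q
change true  (at s t)    q = cross s t q
change true  (above s t) q = cross s t q

changes : ∀ {n} → Vec Bool n → Vec Cell n → Vec ℤ n → ℤ
changes [] [] [] = 0ℤ
changes (b ∷ bs) (c ∷ cs) (q ∷ qs) = change b c q + changes bs cs qs

Descends : Vec Cell 5 → Vec Bool 5 → Set
Descends cs bs = changes bs cs (offset 0ℤ (zipWith coeff bs cs)) ≤ᶻ -1ℤ

descends? : ∀ cs bs → Dec (Descends cs bs)
descends? cs bs = _ ≤? _

-- A fitting coordinate lies between 0 and the corner, which is a + `sgn s q` after signing. At a
-- zero coordinate this only asks for 0 ≤ a + `sgn s q`, which -2 ensures because a ≥ 2.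
Fits : Sign → Cell → ℤ → Set
Fits s zero         q = - (+ 2) ≤ᶻ sgn s q
Fits s (below s′ t) q = s ≡ s′ × t ≤ᶻ sgn s q
Fits s (at s′ t)    q = s ≡ s′ × t ≤ᶻ sgn s q
Fits s (above s′ t) q = ⊥

fits? : ∀ s c q → Dec (Fits s c q)
fits? s zero         q = _ ≤? _
fits? s (below s′ t) q = (s Sign.≟ s′) ×-dec (_ ≤? _)
fits? s (at s′ t)    q = (s Sign.≟ s′) ×-dec (_ ≤? _)
fits? s (above s′ t) q = no λ()

AllFit : ∀ {n} → Vec Sign n → Vec Cell n → Vec ℤ n → Set
AllFit [] [] [] = ⊤
AllFit (s ∷ ss) (c ∷ cs) (q ∷ qs) = Fits s c q × AllFit ss cs qs

allFit? : ∀ {n} ss cs qs → Dec (AllFit {n} ss cs qs)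
allFit? [] [] [] = yes tt
allFit? (s ∷ ss) (c ∷ cs) (q ∷ qs) = fits? s c q ×-dec allFit? ss cs qs

-- The vector h carries every row of U with coefficient ½; adding -1 makes it -½.
corner : Sign → ℤ
corner ⊕ = 0ℤ
corner ⊖ = -1ℤ

-- point a 1ℤ (map corner ss) is the vector h(ss).
Boxed : Vec Cell 5 → Vec Sign 5 → Set
Boxed cs ss = AllFit ss cs q × signedSum ss q ≡ + 3
  where q = offset 1ℤ (map corner ss)

boxed? : ∀ cs ss → Dec (Boxed cs ss)
boxed? cs ss = allFit? _ _ _ ×-dec (_ ≟ _)

-- Finite enumeration of sign patterns and cells

choices : ∀ {A : Set} {n} → Vec (List A) n → List (Vec A n)
choices []         = [] ∷ []
choices (xs ∷ xss) = List.concatMap (λ x → List.map (x ∷_) (choices xss)) xs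

signs : Cell → List Sign
signs zero        = ⊕ ∷ ⊖ ∷ []
signs (below s _) = s ∷ []
signs (at s _)    = s ∷ []
signs (above s _) = s ∷ []

bits : Cell → List Bool
bits (at _ _)    = false ∷ true ∷ []
bits (above _ _) = true ∷ false ∷ []
bits _           = false ∷ []

Good : Vec Cell 5 → Set
Good cs = Any (Boxed cs) (choices (map signs cs)) ⊎ Any (Descends cs) (choices (map bits cs))

good? : ∀ cs → Dec (Good cs)
good? cs = Any.any? (boxed? cs) _ ⊎-dec Any.any? (descends? cs) _

AllChoices : ∀ {A : Set} {n} → Vec (List A) n → (Vec A n → Set) → Set
AllChoices []       P = P []
AllChoices (l ∷ ls) P = All (λ c → AllChoices ls (P ∘ (c ∷_))) l

allChoices? : ∀ {A : Set} {n} (ls : Vec (List A) n) {P : Vec A n → Set} →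
  (∀ cs → Dec (P cs)) → Dec (AllChoices ls P)
allChoices? []       P? = P? []
allChoices? (l ∷ ls) P? = All.all? (λ c → allChoices? ls (λ cs → P? (c ∷ cs))) l

choose : ∀ {A X : Set} {n} {R : X → A → Set} {ls : Vec (List A) n} {xs : Vec X n} {P} →
  Pointwise (λ x → Any (R x)) xs ls → AllChoices ls P → ∃ λ cs → Pointwise R xs cs × P cs
choose []       p  = [] , [] , p
choose {R = R} {ls = l ∷ ls} {xs = x ∷ xs} {P} (r ∷ rs) ps = pick r ps
  where
  pick : ∀ {l} → Any (R x) l → All (λ c → AllChoices ls (P ∘ (c ∷_))) l → ∃ λ cs → Pointwise R (x ∷ xs) cs × P cs
  pick (here r)  (p ∷ _)  = let cs , rs′ , p′ = choose rs p in _ ∷ cs , r ∷ rs′ , p′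
  pick (there r) (_ ∷ ps) = pick r ps

levels : Sign → ℤ → ℕ → List Cell
levels s t zero    = below s t ∷ []
levels s t (suc n) = at s t ∷ levels s (t - 1ℤ) n

data Pattern : Set where
  none : Pattern
  some : Sign → Pattern

Matches : ℤ → Pattern → Set
Matches x none     = x ≡ 0ℤ
Matches x (some s) = 1ℤ ≤ᶻ sgn s x

patterns : List Pattern
patterns = none ∷ some ⊕ ∷ some ⊖ ∷ []

value gap : Pattern → ℤ
value none     = 0ℤ
value (some s) = sgn s 1ℤ
gap none     = 1ℤ
gap (some s) = 0ℤ

cells : Pattern → ℤ → ℤ → List Cell
cells none     _ _ = zero ∷ []
cells (some s) q n = above s (t + 1ℤ) ∷ levels s t ∣ n ∣
  -- All column sums of `B` are even, so with the arguments supplied by `plan` this division is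
  -- exact.
  where t = (sgn s q + n) /ℕ 2

cellsAll : ∀ {n} → Vec Pattern n → Vec ℤ n → Vec ℤ n → Vec (List Cell) n
cellsAll []       []       []       = []
cellsAll (p ∷ ps) (q ∷ qs) (n ∷ ns) = cells p q n ∷ cellsAll ps qs ns

-- With the zero coordinates of ps signed to suit coordinate i, its box reaches up to the
-- cut a + t of cells; with any other signs it is shorter by at most the i-th entry of the
-- last vector, so the levels below the cut that matter are as many as that.
plan : Vec Pattern 5 → Vec (List Cell) 5
plan ps = cellsAll ps (combine (map value ps) B) (combine (map gap ps) (map (map (λ x → + ∣ x ∣)) B))

GoodPatterns : Set
GoodPatterns = AllChoices (replicate 5 patterns) (λ ps → AllChoices (plan ps) Good)

goodPatterns? : Dec GoodPatterns
goodPatterns? = allChoices? (replicate 5 patterns) (λ ps → allChoices? (plan ps) good?)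

-- The computation runs over 243 patterns and about nine thousand vectors of cells.
goodPatterns?-does : does goodPatterns? ≡ true
goodPatterns?-does = refl

from-does : ∀ {P : Set} (P? : Dec P) → does P? ≡ true → P
from-does (yes p) _ = p

abstract
  -- Only the Boolean above is computed; opacity keeps the large proof term from being unfolded
  -- later.
  goodPatterns : GoodPatterns
  goodPatterns = from-does goodPatterns? goodPatterns?-does

-- Soundness of the enumeration

pattern-cover : ∀ x → Any (Matches x) patterns
pattern-cover (+ zero)   = here refl
pattern-cover (+ suc n)  = there (here (+≤+ (s≤s z≤n)))
pattern-cover (-[1+ n ]) = there (there (here (+≤+ (s≤s z≤n))))

patterns-cover : ∀ {n} (xs : Vec ℤ n) → Pointwise (λ x → Any (Matches x)) xs (replicate n patterns)
patterns-cover []       = []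
patterns-cover (x ∷ xs) = pattern-cover x ∷ patterns-cover xs

module _ {a : ℤ} (2≤a : + 2 ≤ᶻ a) where

  stay-sound : ∀ s {x} q → 1ℤ ≤ᶻ sgn s x → + ∣ x - entry a 0ℤ 0ℤ q ∣ ≤ᶻ + ∣ x ∣ + stay s q
  stay-sound s {x} q 1≤x = subst (λ v → + ∣ x - v ∣ ≤ᶻ + ∣ x ∣ + stay s q) (sym a0+q≡q)
    (∣x-v∣≤∣x∣+d-signed s (ℤₚ.≤-trans (+≤+ z≤n) 1≤x) (ℤₚ.i≤i⊔j (- sgn s q) _)
      (ℤₚ.≤-trans
        (≤-from (ℤₚ.+-mono-≤ 1≤x 1≤x)
          (solve 2 (λ x q → (x :+ x) :- (con (+ 2)) := (q :- con (+ 2)) :- (q :- (x :+ x))) refl (sgn s x) (sgn s q)))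
        (ℤₚ.i≤j⊔i (- sgn s q) _)))
    where
    a0+q≡q : a * 0ℤ + q ≡ q
    a0+q≡q = solve 2 (λ a q → a :* con 0ℤ :+ q := q) refl a q

  cross-sound : ∀ s t {x} q → 1ℤ ≤ᶻ sgn s x → a + t ≤ᶻ sgn s x →
    + ∣ x - entry a 0ℤ (sgn s 1ℤ) q ∣ ≤ᶻ + ∣ x ∣ + cross s t q
  cross-sound s t {x} q 1≤x a+t≤x =
    ∣x-v∣≤∣x∣+d-signed s (ℤₚ.≤-trans (+≤+ z≤n) 1≤x)
      (ℤₚ.≤-trans
        (≤-from (ℤₚ.+-mono-≤ 2≤a 2≤a) (trans
          (solve 2 (λ a q → (a :+ a) :- con (+ 4) := :- (con (+ 4) :+ q) :- :- (a :+ a :+ q)) refl a (sgn s q))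
          (cong (λ v → - (+ 4 + sgn s q) - - v) (sym (sgn-entry s)))))
        (ℤₚ.i≤i⊔j (- (+ 4 + sgn s q)) _))
      (ℤₚ.≤-trans
        (≤-from (ℤₚ.+-mono-≤ a+t≤x a+t≤x) (trans
          (solve 4 (λ a t x q → (x :+ x) :- ((a :+ t) :+ (a :+ t)) := (q :- (t :+ t)) :- ((a :+ a :+ q) :- (x :+ x))) refl a t (sgn s x) (sgn s q))
          (cong (λ v → (sgn s q - (t + t)) - (v - (sgn s x + sgn s x))) (sym (sgn-entry s)))))
        (ℤₚ.i≤j⊔i (- (+ 4 + sgn s q)) _))
    where
    sgn-entry : ∀ s → sgn s (entry a 0ℤ (sgn s 1ℤ) q) ≡ a + a + sgn s q
    sgn-entry ⊕ = solve 2 (λ a q → a :* con (+ 2) :+ q := a :+ a :+ q) refl a q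
    sgn-entry ⊖ = solve 2 (λ a q → :- (a :* con (- + 2) :+ q) := a :+ a :+ :- q) refl a q

  change-sound : ∀ b c {x} q → a ⊢ x ∈ c →
    + ∣ x - entry a 0ℤ (coeff b c) q ∣ ≤ᶻ + ∣ x ∣ + change b c q
  change-sound b zero q refl = subst₂ _≤ᶻ_ (cong (λ c → + ∣ 0ℤ - entry a 0ℤ c q ∣) (sym (coeff-zero b))) (sym (ℤₚ.+-identityˡ _))
    (≤-trans (ℤₚ.≤-reflexive (cong (λ v → + ∣ v ∣) (solve 2 (λ a q → con 0ℤ :- (a :* con 0ℤ :+ q) := :- q) refl a q)))
      (∣-q∣≤ q))
    where
    open ℤₚ using (≤-trans)
    coeff-zero : ∀ b → coeff b zero ≡ 0ℤ
    coeff-zero true  = refl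
    coeff-zero false = refl
    ∣-q∣≤ : ∀ q → + ∣ - q ∣ ≤ᶻ (- q) ⊔ q
    ∣-q∣≤ (+ n)    = ≤-trans (ℤₚ.≤-reflexive (cong +_ (ℤₚ.∣-i∣≡∣i∣ (+ n)))) (ℤₚ.i≤j⊔i (- + n) (+ n))
    ∣-q∣≤ -[1+ n ] = ℤₚ.i≤i⊔j (+ suc n) -[1+ n ]
  change-sound true  (below s t) q (p , _) = stay-sound s q p
  change-sound false (below s t) q (p , _) = stay-sound s q p
  change-sound false (at s t)    q (p , _) = stay-sound s q p
  change-sound false (above s t) q (p , _) = stay-sound s q p
  change-sound true  (at s t)    q (p , r) = cross-sound s t q p (ℤₚ.≤-reflexive (sym r))
  change-sound true  (above s t) q (p , r) = cross-sound s t q p r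

  changes-sound : ∀ {n} bs (cs : Vec Cell n) qs {xs} → Pointwise (a ⊢_∈_) xs cs →
    + norm (xs ⊝ zipWith (entry a 0ℤ) (zipWith coeff bs cs) qs) ≤ᶻ + norm xs + changes bs cs qs
  changes-sound [] [] [] [] = +≤+ z≤n
  changes-sound (b ∷ bs) (c ∷ cs) (q ∷ qs) {x ∷ xs} (r ∷ rs) =
    ℤₚ.≤-trans (ℤₚ.+-mono-≤ (change-sound b c q r) (changes-sound bs cs qs rs))
      (ℤₚ.≤-reflexive (solve 4 (λ x d y e → (x :+ d) :+ (y :+ e) := (x :+ y) :+ (d :+ e)) refl
        (+ ∣ x ∣) (change b c q) (+ norm xs) (changes bs cs qs)))

  fits-sound : ∀ s c q {x} → Fits s c q → a ⊢ x ∈ c → 0ℤ ≤ᶻ sgn s x × sgn s x ≤ᶻ a + sgn s q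
  fits-sound ⊕ zero q f refl = ℤₚ.≤-refl , ℤₚ.+-mono-≤ 2≤a f
  fits-sound ⊖ zero q f refl = ℤₚ.≤-refl , ℤₚ.+-mono-≤ 2≤a f
  fits-sound s (below s t) q (refl , t≤q) (p , r) =
    ℤₚ.≤-trans (+≤+ z≤n) p , ℤₚ.≤-trans r (ℤₚ.+-monoʳ-≤ a t≤q)
  fits-sound s (at s t) q (refl , t≤q) (p , r) =
    ℤₚ.≤-trans (+≤+ z≤n) p , ℤₚ.≤-trans (ℤₚ.≤-reflexive r) (ℤₚ.+-monoʳ-≤ a t≤q)

  -- A coordinate x between 0 and v splits ∣v∣ into ∣x - v∣ + ∣x∣, and at a corner ∣v∣ is a +
  -- `sgn s q`; the sum over the coordinates is the norm of the corner.
  allFit-sound : ∀ {n} ss (cs : Vec Cell n) qs {xs} → AllFit ss cs qs → Pointwise (a ⊢_∈_) xs cs →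
    + norm (xs ⊝ zipWith (entry a 1ℤ) (map corner ss) qs) + + norm xs ≡ + n * a + signedSum ss qs
  allFit-sound [] [] [] _ [] = refl
  allFit-sound {suc n} (s ∷ ss) (c ∷ cs) (q ∷ qs) {x ∷ xs} (f , fs) (r ∷ rs) =
    let 0≤x , x≤v = fits-sound s c q f r
        v = entry a 1ℤ (corner s) q
    in begin
    (+ ∣ x - v ∣ + + norm ys) + (+ ∣ x ∣ + + norm xs)
      ≡⟨ solve 4 (λ x d y e → (x :+ d) :+ (y :+ e) := (x :+ y) :+ (d :+ e)) refl (+ ∣ x - v ∣) (+ norm ys) (+ ∣ x ∣) (+ norm xs) ⟩
    (+ ∣ x - v ∣ + + ∣ x ∣) + (+ norm ys + + norm xs)
      ≡⟨ cong₂ _+_ (cong₂ (λ i j → + i + + j) (sym (∣sgn-sgn∣ s x v)) (sym (∣sgn∣ s x))) (allFit-sound ss cs qs fs rs) ⟩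
    (+ ∣ sgn s x - sgn s v ∣ + + ∣ sgn s x ∣) + (+ n * a + signedSum ss qs)
      ≡⟨ cong (_+ (+ n * a + signedSum ss qs)) (∣x-v∣+∣x∣≡v _ _ 0≤x (subst (sgn s x ≤ᶻ_) (sym (sgn-entry s)) x≤v)) ⟩
    sgn s v + (+ n * a + signedSum ss qs)
      ≡⟨ cong (_+ (+ n * a + signedSum ss qs)) (sgn-entry s) ⟩
    (a + sgn s q) + (+ n * a + signedSum ss qs)
      ≡⟨ solve 4 (λ a q n r → (a :+ q) :+ (n :* a :+ r) := (con 1ℤ :+ n) :* a :+ (q :+ r)) refl a (sgn s q) (+ n) (signedSum ss qs) ⟩
    + suc n * a + (sgn s q + signedSum ss qs) ∎
    where
    open ≡-Reasoning
    ys = xs ⊝ zipWith (entry a 1ℤ) (map corner ss) qs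
    sgn-entry : ∀ s → sgn s (entry a 1ℤ (corner s) q) ≡ a + sgn s q
    sgn-entry ⊕ = solve 2 (λ a q → a :* con 1ℤ :+ q := a :+ q) refl a q
    sgn-entry ⊖ = solve 2 (λ a q → :- (a :* con -1ℤ :+ q) := a :+ :- q) refl a q

  levels-cover : ∀ s t n {x} → 1ℤ ≤ᶻ sgn s x → sgn s x ≤ᶻ a + t → Any (a ⊢ x ∈_) (levels s t n)
  levels-cover s t zero    p q = here (p , q)
  levels-cover s t (suc n) {x} p q with sgn s x ≟ a + t
  ... | yes r = here (p , r)
  ... | no ¬r = there (levels-cover s (t - 1ℤ) n p
    (≤-from (ℤₚ.i<j⇒suc[i]≤j (ℤₚ.≤∧≢⇒< q ¬r))
      (solve 3 (λ a t x → (a :+ t) :- (con 1ℤ :+ x) := (a :+ (t :- con 1ℤ)) :- x) refl a t (sgn s x))))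

  cells-cover : ∀ p q n {x} → Matches x p → Any (a ⊢ x ∈_) (cells p q n)
  cells-cover none     q n m = here m
  cells-cover (some s) q n {x} m with sgn s x ≤? a + (sgn s q + n) /ℕ 2
  ... | yes r = there (levels-cover s _ ∣ n ∣ m r)
  ... | no ¬r = here (m , ≤-from (ℤₚ.i<j⇒suc[i]≤j (ℤₚ.≰⇒> ¬r))
      (solve 3 (λ a t x → x :- (con 1ℤ :+ (a :+ t)) := x :- (a :+ (t :+ con 1ℤ))) refl a ((sgn s q + n) /ℕ 2) (sgn s x)))

  cellsAll-cover : ∀ {n} ps qs (ns : Vec ℤ n) {xs : Vec ℤ n} → Pointwise Matches xs ps →
    Pointwise (λ x → Any (a ⊢ x ∈_)) xs (cellsAll ps qs ns)
  cellsAll-cover []       []       []       []       = []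
  cellsAll-cover (p ∷ ps) (q ∷ qs) (n ∷ ns) (m ∷ ms) = cells-cover p q n m ∷ cellsAll-cover ps qs ns ms

  -- The sign pattern of `x` fixes the cut levels, the cells locate `x` against them, and the table
  -- decides. A descending move has c = 0, a corner has c = 1.
  descend-or-box : ∀ x →
    (∃₂ λ c e → norm (x ⊝ point a c e) < norm x) ⊎
    (∃₂ λ c e → + norm (x ⊝ point a c e) + + norm x ≡ + 5 * a + + 3)
  descend-or-box x =
    let ps , ms , good = choose {P = λ ps → AllChoices (plan ps) Good} (patterns-cover x) goodPatterns
        cs , rs , g    = choose {P = Good} (cellsAll-cover ps _ _ ms) good
    in conclude cs rs g
    where
    conclude : ∀ cs → Pointwise (a ⊢_∈_) x cs → Good cs → _
    conclude cs rs (inj₁ box) =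
      let ss , fs , sum≡3 = Any.satisfied box
      in inj₂ (1ℤ , map corner ss , trans (allFit-sound ss cs _ fs rs) (cong (_+_ (+ 5 * a)) sum≡3))
    conclude cs rs (inj₂ move) =
      let bs , d = Any.satisfied move
          e = zipWith coeff bs cs
      in inj₁ (0ℤ , e , ℤₚ.drop‿+<+ (ℤₚ.suc[i]≤j⇒i<j
        (≤-from (ℤₚ.≤-trans (changes-sound bs cs _ rs) (ℤₚ.+-monoʳ-≤ (+ norm x) d))
          (solve 2 (λ x y → (x :+ con -1ℤ) :- y := x :- (con 1ℤ :+ y)) refl
            (+ norm x) (+ norm (x ⊝ point a 0ℤ e))))))

-- Generators, order and the relations between the generators

poly : List ℕ → List ℤ
poly = List.map (λ c → + c)

order : List ℕ
order = 8 ∷ 42 ∷ 84 ∷ 84 ∷ 48 ∷ 16 ∷ []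

generators : Vec (List ℕ) 5
generators
  = (1 ∷ [])
  ∷ (11 ∷ 36 ∷ 38 ∷ 24 ∷ 8 ∷ [])
  ∷ (10 ∷ 41 ∷ 56 ∷ 36 ∷ 16 ∷ [])
  ∷ (15 ∷ 52 ∷ 64 ∷ 40 ∷ 16 ∷ [])
  ∷ (20 ∷ 75 ∷ 94 ∷ 60 ∷ 24 ∷ [])
  ∷ []

weights : ℤ → Vec ℤ 5
weights a = map (λ p → eval (poly p) a) generators

:weights : ∀ {n} → Polynomial n → Vec (Polynomial n) 5
:weights a = map (λ p → Formal.eval (poly p) a) generators

order∣point : ∀ a c e → ∃ λ r → dot (weights a) (point a c e) ≡ r * eval (poly order) a
order∣point a c (e₁ ∷ e₂ ∷ e₃ ∷ e₄ ∷ e₅ ∷ []) =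
  -- The weights pair with u₁, ..., u₅ to 0, 1, 2, 2, 3 times the order, and with h to half their
  -- sum.
  + 4 * c + (e₂ + + 2 * e₃ + + 2 * e₄ + + 3 * e₅) ,
  solve 7 (λ a c e₁ e₂ e₃ e₄ e₅ →
    Formal.dot (:weights a) (Formal.point a c (e₁ ∷ e₂ ∷ e₃ ∷ e₄ ∷ e₅ ∷ []))
      := (con (+ 4) :* c :+ (e₂ :+ con (+ 2) :* e₃ :+ con (+ 2) :* e₄ :+ con (+ 3) :* e₅)) :* Formal.eval (poly order) a)
    refl a c e₁ e₂ e₃ e₄ e₅

-- The columns (polynomials in a) are the coordinates with respect to h, u₁, …, u₅ of the basis
-- (n, 0, 0, 0, 0), (-g₂, 1, 0, 0, 0), …, (-g₅, 0, 0, 0, 1) of the lattice of relations.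
hermite : Vec (Vec (List ℤ) 5) 6
hermite
  = ((+ 6 ∷ + 16 ∷ + 12 ∷ []) ∷ (- + 8 ∷ - + 6 ∷ []) ∷ (- + 7 ∷ - + 12 ∷ [])
      ∷ (- + 10 ∷ - + 12 ∷ []) ∷ (- + 15 ∷ - + 18 ∷ []) ∷ [])
  ∷ ((+ 2 ∷ + 10 ∷ + 20 ∷ + 20 ∷ + 8 ∷ []) ∷ (- + 3 ∷ - + 8 ∷ - + 10 ∷ - + 4 ∷ []) ∷ (- + 3 ∷ - + 9 ∷ - + 14 ∷ - + 8 ∷ [])
      ∷ (- + 4 ∷ - + 12 ∷ - + 16 ∷ - + 8 ∷ []) ∷ (- + 5 ∷ - + 17 ∷ - + 24 ∷ - + 12 ∷ []) ∷ [])
  ∷ ((- + 2 ∷ - + 4 ∷ + 0 ∷ + 4 ∷ []) ∷ (+ 3 ∷ + 0 ∷ - + 2 ∷ []) ∷ (+ 2 ∷ + 3 ∷ - + 4 ∷ [])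
      ∷ (+ 3 ∷ + 2 ∷ - + 4 ∷ []) ∷ (+ 5 ∷ + 3 ∷ - + 6 ∷ []) ∷ [])
  ∷ ((- + 3 ∷ - + 6 ∷ + 0 ∷ + 4 ∷ []) ∷ (+ 4 ∷ + 0 ∷ - + 2 ∷ []) ∷ (+ 4 ∷ + 3 ∷ - + 4 ∷ [])
      ∷ (+ 5 ∷ + 2 ∷ - + 4 ∷ []) ∷ (+ 8 ∷ + 3 ∷ - + 6 ∷ []) ∷ [])
  ∷ ([] ∷ [] ∷ [] ∷ [] ∷ [] ∷ [])
  ∷ ((- + 5 ∷ - + 16 ∷ - + 16 ∷ - + 4 ∷ []) ∷ (+ 7 ∷ + 8 ∷ + 2 ∷ []) ∷ (+ 6 ∷ + 13 ∷ + 4 ∷ [])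
      ∷ (+ 9 ∷ + 14 ∷ + 4 ∷ []) ∷ (+ 13 ∷ + 21 ∷ + 6 ∷ []) ∷ [])
  ∷ []

module Basis {A : Set} (ι : ℤ → A) (_⊞_ _⊠_ : A → A → A) where

  module L = Linear ι _⊞_ _⊠_

  coordinates : A → A → Vec A 4 → Vec A 6
  coordinates a r w = map (λ row → L.dot (map (λ p → L.eval p a) row) (r ∷ w)) hermite

  combination : A → A → Vec A 4 → Vec A 5
  combination a r w = L.point a (head v) (tail v)
    where v = coordinates a r w

open Basis id _+_ _*_ using (coordinates; combination)
module FormalBasis {n} = Basis {Polynomial n} con _:+_ _:*_

combination-correct : ∀ a r w →
  combination a r w ≡ r * eval (poly order) a - dot (tail (weights a)) w ∷ w
combination-correct a r (w₂ ∷ w₃ ∷ w₄ ∷ w₅ ∷ []) = cong₂ _∷_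
  (solve 6 (λ a r w₂ w₃ w₄ w₅ → let w = w₂ ∷ w₃ ∷ w₄ ∷ w₅ ∷ [] in
    head (FormalBasis.combination a r w) := r :* Formal.eval (poly order) a :- Formal.dot (tail (:weights a)) w)
    refl a r w₂ w₃ w₄ w₅)
  (cong₂ _∷_ (solve 6 (λ a r w₂ w₃ w₄ w₅ →
    Vec.lookup (FormalBasis.combination a r (w₂ ∷ w₃ ∷ w₄ ∷ w₅ ∷ [])) (# 1) := w₂)
    refl a r w₂ w₃ w₄ w₅)
  (cong₂ _∷_ (solve 6 (λ a r w₂ w₃ w₄ w₅ →
    Vec.lookup (FormalBasis.combination a r (w₂ ∷ w₃ ∷ w₄ ∷ w₅ ∷ [])) (# 2) := w₃)
    refl a r w₂ w₃ w₄ w₅)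
  (cong₂ _∷_ (solve 6 (λ a r w₂ w₃ w₄ w₅ →
    Vec.lookup (FormalBasis.combination a r (w₂ ∷ w₃ ∷ w₄ ∷ w₅ ∷ [])) (# 3) := w₄)
    refl a r w₂ w₃ w₄ w₅)
  (cong₂ _∷_ (solve 6 (λ a r w₂ w₃ w₄ w₅ →
    Vec.lookup (FormalBasis.combination a r (w₂ ∷ w₃ ∷ w₄ ∷ w₅ ∷ [])) (# 4) := w₅)
    refl a r w₂ w₃ w₄ w₅) refl))))

-- Doubling h gives the sum of the rows of U.
point-shift : ∀ a c q e → point a (c + q * + 2) e ≡ point a c (map (_+_ q) e)
point-shift a c q (e₁ ∷ e₂ ∷ e₃ ∷ e₄ ∷ e₅ ∷ []) =
  cong₂ _∷_ (solve 8 (λ a c q e₁ e₂ e₃ e₄ e₅ → let e = e₁ ∷ e₂ ∷ e₃ ∷ e₄ ∷ e₅ ∷ [] in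
    Vec.lookup (Formal.point a (c :+ q :* con (+ 2)) e) (# 0) := Vec.lookup (Formal.point a c (map (q :+_) e)) (# 0))
    refl a c q e₁ e₂ e₃ e₄ e₅)
  (cong₂ _∷_ (solve 8 (λ a c q e₁ e₂ e₃ e₄ e₅ → let e = e₁ ∷ e₂ ∷ e₃ ∷ e₄ ∷ e₅ ∷ [] in
    Vec.lookup (Formal.point a (c :+ q :* con (+ 2)) e) (# 1) := Vec.lookup (Formal.point a c (map (q :+_) e)) (# 1))
    refl a c q e₁ e₂ e₃ e₄ e₅)
  (cong₂ _∷_ (solve 8 (λ a c q e₁ e₂ e₃ e₄ e₅ → let e = e₁ ∷ e₂ ∷ e₃ ∷ e₄ ∷ e₅ ∷ [] in
    Vec.lookup (Formal.point a (c :+ q :* con (+ 2)) e) (# 2) := Vec.lookup (Formal.point a c (map (q :+_) e)) (# 2))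
    refl a c q e₁ e₂ e₃ e₄ e₅)
  (cong₂ _∷_ (solve 8 (λ a c q e₁ e₂ e₃ e₄ e₅ → let e = e₁ ∷ e₂ ∷ e₃ ∷ e₄ ∷ e₅ ∷ [] in
    Vec.lookup (Formal.point a (c :+ q :* con (+ 2)) e) (# 3) := Vec.lookup (Formal.point a c (map (q :+_) e)) (# 3))
    refl a c q e₁ e₂ e₃ e₄ e₅)
  (cong₂ _∷_ (solve 8 (λ a c q e₁ e₂ e₃ e₄ e₅ → let e = e₁ ∷ e₂ ∷ e₃ ∷ e₄ ∷ e₅ ∷ [] in
    Vec.lookup (Formal.point a (c :+ q :* con (+ 2)) e) (# 4) := Vec.lookup (Formal.point a c (map (q :+_) e)) (# 4))
    refl a c q e₁ e₂ e₃ e₄ e₅) refl))))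

-- As the first generator is 1, a relation is determined by `r` and its last four entries, which are
-- its coefficients in the basis behind `hermite`. Since 2h is the sum of the rows of U, the
-- coefficient of h can then be reduced to its parity.
relation-point : ∀ a r w → dot (weights a) w ≡ r * eval (poly order) a →
  ∃ λ e → w ≡ point a 0ℤ e ⊎ w ≡ point a 1ℤ e
relation-point a r (w₁ ∷ w) rel = reduce (c %ℕ 2) (n%ℕd<d c 2) (a≡a%ℕn+[a/ℕn]*n c 2)
  where
  c = head (coordinates a r w)
  e = tail (coordinates a r w)
  W = eval (poly order) a
  D = dot (tail (weights a)) w
  w≡point : w₁ ∷ w ≡ point a c e
  w≡point = begin
    w₁ ∷ w
      ≡⟨ cong (_∷ w) (solve 3 (λ a w D → w := ((con 1ℤ :+ a :* con 0ℤ) :* w :+ D) :- D) refl a w₁ D) ⟩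
    (dot (weights a) (w₁ ∷ w) - D) ∷ w
      ≡⟨ cong (λ z → z - D ∷ w) rel ⟩
    (r * W - D) ∷ w
      ≡⟨ combination-correct a r w ⟨
    point a c e ∎
    where open ≡-Reasoning
  reduce : ∀ b → b < 2 → c ≡ + b + (c /ℕ 2) * + 2 → ∃ λ e → w₁ ∷ w ≡ point a 0ℤ e ⊎ w₁ ∷ w ≡ point a 1ℤ e
  reduce b b<2 eq = map (_+_ (c /ℕ 2)) e , parity _ (map (_+_ (c /ℕ 2)) e) b b<2 (begin
    w₁ ∷ w                                  ≡⟨ w≡point ⟩
    point a c e                             ≡⟨ cong (λ z → point a z e) eq ⟩
    point a (+ b + (c /ℕ 2) * + 2) e        ≡⟨ point-shift a (+ b) (c /ℕ 2) e ⟩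
    point a (+ b) (map (_+_ (c /ℕ 2)) e)     ∎)
    where
    open ≡-Reasoning
    parity : ∀ w e b → b < 2 → w ≡ point a (+ b) e → w ≡ point a 0ℤ e ⊎ w ≡ point a 1ℤ e
    parity _ _ 0 _ eq = inj₁ eq
    parity _ _ 1 _ eq = inj₂ eq
    parity _ _ (suc (suc b)) (s≤s (s≤s ())) eq

-- Walks as integer vectors

dot-zero : ∀ {n} (gs : Vec ℤ n) → dot gs (replicate n 0ℤ) ≡ 0ℤ
dot-zero []       = refl
dot-zero (g ∷ gs) = cong₂ _+_ (ℤₚ.*-zeroʳ g) (dot-zero gs)

repeat-step : ∀ {n} (gs : Vec ℤ n) {s} → IsStep (Vec.toList gs) s → ∀ k steps →
  All (IsStep (Vec.toList gs)) steps →
  ∃ λ steps′ → List.length steps′ ≡ k ℕ.+ List.length steps × All (IsStep (Vec.toList gs)) steps′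
    × sumℤ steps′ ≡ + k * s + sumℤ steps
repeat-step gs {s} is zero    steps all = steps , refl , all , sym (trans (cong (_+ sumℤ steps) (ℤₚ.*-zeroˡ s)) (ℤₚ.+-identityˡ _))
repeat-step gs {s} is (suc k) steps all =
  let steps′ , len , all′ , sum = repeat-step gs is k steps all
  in s ∷ steps′ , cong suc len , is ∷ all′ ,
     trans (cong (_+_ s) sum) (solve 3 (λ s k r → s :+ (k :* s :+ r) := (con 1ℤ :+ k) :* s :+ r) refl s (+ k) (sumℤ steps))

vector⇒steps : ∀ {n} (gs xs : Vec ℤ n) →
  ∃ λ steps → List.length steps ≡ norm xs × All (IsStep (Vec.toList gs)) steps × sumℤ steps ≡ dot gs xs
vector⇒steps [] [] = [] , refl , [] , refl
vector⇒steps (g ∷ gs) (x ∷ xs) =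
  let steps , len , all , sum = vector⇒steps gs xs
      s , is , eq = signedStep x
      steps′ , len′ , all′ , sum′ = repeat-step (g ∷ gs) is ∣ x ∣ steps (All.map (λ (h , h∈ , or) → h , there h∈ , or) all)
  in steps′ , trans len′ (cong (ℕ._+_ ∣ x ∣) len) , all′ , trans sum′ (cong₂ _+_ eq sum)
  where
  signedStep : ∀ x → ∃ λ s → IsStep (Vec.toList (g ∷ gs)) s × + ∣ x ∣ * s ≡ g * x
  signedStep (+ k)    = g , (g , here refl , inj₁ refl) , ℤₚ.*-comm (+ k) g
  signedStep -[1+ k ] = - g , (g , here refl , inj₂ refl) ,
    solve 2 (λ k g → k :* (:- g) := g :* (:- k)) refl (+ suc k) g

add-step : ∀ {n} (gs xs : Vec ℤ n) {s} → IsStep (Vec.toList gs) s →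
  ∃ λ xs′ → norm xs′ ≤ suc (norm xs) × dot gs xs′ ≡ s + dot gs xs
add-step (g ∷ gs) (x ∷ xs) (_ , here refl , inj₁ refl) =
  1ℤ + x ∷ xs , ℕₚ.+-monoˡ-≤ (norm xs) (ℤₚ.∣i+j∣≤∣i∣+∣j∣ 1ℤ x) ,
  solve 3 (λ g x d → g :* (con 1ℤ :+ x) :+ d := g :+ (g :* x :+ d)) refl g x (dot gs xs)
add-step (g ∷ gs) (x ∷ xs) (_ , here refl , inj₂ refl) =
  -1ℤ + x ∷ xs , ℕₚ.+-monoˡ-≤ (norm xs) (ℤₚ.∣i+j∣≤∣i∣+∣j∣ -1ℤ x) ,
  solve 3 (λ g x d → g :* (con -1ℤ :+ x) :+ d := :- g :+ (g :* x :+ d)) refl g x (dot gs xs)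
add-step (g ∷ gs) (x ∷ xs) {s} (h , there h∈ , or) =
  let xs′ , norm≤ , eq = add-step gs xs (h , h∈ , or)
  in x ∷ xs′ ,
     ℕₚ.≤-trans (ℕₚ.+-monoʳ-≤ ∣ x ∣ norm≤) (ℕₚ.≤-reflexive (ℕₚ.+-suc ∣ x ∣ (norm xs))) ,
     trans (cong (_+_ (g * x)) eq) (solve 3 (λ y s d → y :+ (s :+ d) := s :+ (y :+ d)) refl (g * x) s (dot gs xs))

-- The norm may fall below the length, because opposite steps cancel.
steps⇒vector : ∀ {n} (gs : Vec ℤ n) {steps} → All (IsStep (Vec.toList gs)) steps →
  ∃ λ xs → norm xs ≤ List.length steps × dot gs xs ≡ sumℤ steps
steps⇒vector {n} gs [] = replicate n 0ℤ , ℕₚ.≤-reflexive (norm-zero n) , dot-zero gs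
  where
  norm-zero : ∀ n → norm (replicate n 0ℤ) ≡ 0
  norm-zero zero    = refl
  norm-zero (suc n) = norm-zero n
steps⇒vector gs {s ∷ steps} (is ∷ all) =
  let xs , norm≤ , eq = steps⇒vector gs all
      xs′ , norm≤′ , eq′ = add-step gs xs is
  in xs′ , ℕₚ.≤-trans norm≤′ (s≤s norm≤) , trans eq′ (cong (_+_ s) eq)

-- Upper bound for the diameter

⊝-⊝ : ∀ {n} (xs ys : Vec ℤ n) → ys ≡ xs ⊝ (xs ⊝ ys)
⊝-⊝ []       []       = refl
⊝-⊝ (x ∷ xs) (y ∷ ys) = cong₂ _∷_ (solve 2 (λ x y → y := x :- (x :- y)) refl x y) (⊝-⊝ xs ys)

dot-⊝ : ∀ {n} (gs xs ys : Vec ℤ n) → dot gs (xs ⊝ ys) ≡ dot gs xs - dot gs ys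
dot-⊝ []       []       []       = refl
dot-⊝ (g ∷ gs) (x ∷ xs) (y ∷ ys) = trans (cong (_+_ (g * (x - y))) (dot-⊝ gs xs ys))
  (solve 5 (λ g x y d e → g :* (x :- y) :+ (d :- e) := (g :* x :+ d) :- (g :* y :+ e)) refl g x y (dot gs xs) (dot gs ys))

2≤2m : ∀ {m} → 1 ≤ m → + 2 ≤ᶻ + (2 ℕ.* m)
2≤2m 1≤m = +≤+ (ℕₚ.*-monoʳ-≤ 2 1≤m)

small : ∀ m {i j} → i ℕ.+ j ≡ 5 ℕ.* (2 ℕ.* m) ℕ.+ 3 → i ≤ 1 ℕ.+ m ℕ.* 5 ⊎ j ≤ 1 ℕ.+ m ℕ.* 5
small m {i} {j} eq with i ℕ.≤? 1 ℕ.+ m ℕ.* 5 | j ℕ.≤? 1 ℕ.+ m ℕ.* 5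
... | yes p | _     = inj₁ p
... | _     | yes q = inj₂ q
... | no p  | no q  = ⊥-elim (ℕₚ.<-irrefl (sym eq) (ℕₚ.≤-trans (ℕₚ.≤-reflexive (arith m)) (ℕₚ.+-mono-≤ (ℕₚ.≰⇒> p) (ℕₚ.≰⇒> q))))
  where
  arith : ∀ m → suc (5 ℕ.* (2 ℕ.* m) ℕ.+ 3) ≡ (2 ℕ.+ m ℕ.* 5) ℕ.+ (2 ℕ.+ m ℕ.* 5)
  arith = ℕ-ring

translate : ∀ a c e xs → ∃ λ r →
  dot (weights a) xs ≡ dot (weights a) (xs ⊝ point a c e) + r * eval (poly order) a
translate a c e xs =
  let r , eq = order∣point a c e
  in r , (begin
    dot W xs                                ≡⟨ solve 2 (λ x y → x := (x :- y) :+ y) refl (dot W xs) (dot W p) ⟩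
    dot W xs - dot W p + dot W p            ≡⟨ cong₂ _+_ (sym (dot-⊝ W xs p)) eq ⟩
    dot W (xs ⊝ p) + r * eval (poly order) a ∎)
  where
  open ≡-Reasoning
  W = weights a
  p = point a c e

-- Translation by a lattice point keeps the residue modulo the order, so descent on the norm reaches
-- a box with the residue unchanged.
cover : ∀ m → 1 ≤ m → let a = + (2 ℕ.* m) in ∀ xs → Acc _<_ (norm xs) →
  ∃ λ ys → norm ys ≤ 1 ℕ.+ m ℕ.* 5 × ∃ λ r → dot (weights a) xs ≡ dot (weights a) ys + r * eval (poly order) a
cover m 1≤m xs (acc rec) = [ descend , box ]′ (descend-or-box (2≤2m 1≤m) xs)
  where
  a = + (2 ℕ.* m)
  W = weights a
  N = eval (poly order) a
  Goal = ∃ λ ys → norm ys ≤ 1 ℕ.+ m ℕ.* 5 × ∃ λ r → dot W xs ≡ dot W ys + r * N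
  descend : (∃₂ λ c e → norm (xs ⊝ point a c e) < norm xs) → Goal
  descend (c , e , less) =
    let ys , norm≤ , r , eq = cover m 1≤m (xs ⊝ point a c e) (rec less)
        r′ , eq′ = translate a c e xs
    in ys , norm≤ , r + r′ , trans eq′ (trans (cong (_+ r′ * N) eq)
      (solve 4 (λ y r r′ n → y :+ r :* n :+ r′ :* n := y :+ (r :+ r′) :* n) refl (dot W ys) r r′ N))
  box : (∃₂ λ c e → + norm (xs ⊝ point a c e) + + norm xs ≡ + 5 * a + + 3) → Goal
  box (c , e , sum≡) = [ (λ norm≤ → xs ⊝ point a c e , norm≤ , translate a c e xs)
                       , (λ norm≤ → xs , norm≤ , 0ℤ , solve 2 (λ x n → x := x :+ con 0ℤ :* n) refl (dot W xs) N) ]′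
    (small m (ℤₚ.+-injective (trans sum≡ (cong (_+ + 3) (sym (ℤₚ.pos-* 5 (2 ℕ.* m)))))))

-- Lower bound for the diameter

sign : Sign → ℤ
sign s = sgn s 1ℤ

sign* : ∀ s x → sign s * x ≡ sgn s x
sign* ⊕ x = ℤₚ.*-identityˡ x
sign* ⊖ x = ℤₚ.-1*i≡-i x

dot-signs≤norm : ∀ {n} (ss : Vec Sign n) xs → dot (map sign ss) xs ≤ᶻ + norm xs
dot-signs≤norm []       []       = ℤₚ.≤-refl
dot-signs≤norm (s ∷ ss) (x ∷ xs) = ℤₚ.+-mono-≤
  (subst (_≤ᶻ + ∣ x ∣) (sym (sign* s x)) (sgn≤∣∣ s x)) (dot-signs≤norm ss xs)

sumᶻ : ∀ {n} → Vec ℤ n → ℤ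
sumᶻ = Vec.foldr′ _+_ 0ℤ

-- The diagonal entry of B minus the absolute values of the other entries of its row.
rowBound : Vec ℤ 5
rowBound = - + 2 ∷ 0ℤ ∷ - + 2 ∷ - + 2 ∷ - + 2 ∷ []

-- What `term` with c = 1 contains besides a and the summand in x, when row i has its smallest
-- coefficient ±½: e = 0 for ⊖ and e = -1 for ⊕.
surplus : Sign → ℤ → ℤ → ℤ
surplus ⊖ h r = h
surplus ⊕ h r = r - h

signedRows : Vec Sign 5 → Vec ℤ 5
signedRows ss = map (dot (map sign ss)) B

-- The second sum is in fact ½ σ B σ = 3 for the sign vector σ, again by skewness.
SignCheck : Vec Sign 5 → Set
SignCheck ss = Pointwise _≤ᶻ_ rowBound (zipWith sgn ss (signedRows ss))
  × + 3 ≤ᶻ sumᶻ (zipWith (λ f r → f r) (zipWith surplus ss halfSum) (signedRows ss))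

signCheck? : ∀ ss → Dec (SignCheck ss)
signCheck? ss = Pointwise.decidable _≤?_ _ _ ×-dec (_ ≤? _)

allSigns : List Sign
allSigns = ⊕ ∷ ⊖ ∷ []

signChecks : AllChoices (replicate 5 allSigns) SignCheck
signChecks = from-does (allChoices? (replicate 5 allSigns) signCheck?) refl

signCheck : ∀ ss → SignCheck ss
signCheck ss =
  let ss′ , eqs , check = choose {R = _≡_} {P = SignCheck} (covers ss) signChecks
  in subst SignCheck (sym (Pointwise.Pointwise-≡⇒≡ eqs)) check
  where
  covers : ∀ {n} (ss : Vec Sign n) → Pointwise (λ s → Any (s ≡_)) ss (replicate n allSigns)
  covers []       = []
  covers (⊕ ∷ ss) = here refl ∷ covers ss
  covers (⊖ ∷ ss) = there (here refl) ∷ covers ss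

-- What coordinate i and row i contribute to the pairing of the signs σ with x - c h - e U.
module Term {A : Set} (_⊞_ _⊠_ : A → A → A) (⊟_ : A → A) where

  term : A → A → A → A → A → A → A → A
  term a c σ x h e r = ((σ ⊠ x) ⊞ (⊟ (c ⊠ (σ ⊠ (a ⊞ h))))) ⊞ (⊟ (e ⊠ (((a ⊞ a) ⊠ σ) ⊞ r)))

open Term _+_ _*_ -_
module FormalTerm {n} = Term {Polynomial n} _:+_ _:*_ :-_

terms : ∀ {n} → ℤ → ℤ → Vec Sign n → (xs hs es rs : Vec ℤ n) → ℤ
terms a c [] [] [] [] [] = 0ℤ
terms a c (s ∷ ss) (x ∷ xs) (h ∷ hs) (e ∷ es) (r ∷ rs) = term a c (sign s) x h e r + terms a c ss xs hs es rs

-- Regrouping by rows puts each coefficient e_i explicitly into a single term, so the terms can be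
-- bounded separately.
dot-signs-point : ∀ a c ss xs e →
  dot (map sign ss) (xs ⊝ point a c e) ≡ terms a c ss xs halfSum e (signedRows ss)
dot-signs-point a c (s₁ ∷ s₂ ∷ s₃ ∷ s₄ ∷ s₅ ∷ []) (x₁ ∷ x₂ ∷ x₃ ∷ x₄ ∷ x₅ ∷ []) (e₁ ∷ e₂ ∷ e₃ ∷ e₄ ∷ e₅ ∷ []) =
  solve 17 (λ a c s₁ s₂ s₃ s₄ s₅ x₁ x₂ x₃ x₄ x₅ e₁ e₂ e₃ e₄ e₅ →
    let σ = s₁ ∷ s₂ ∷ s₃ ∷ s₄ ∷ s₅ ∷ []
        ρ = map (λ row → Formal.dot σ (map con row)) B
        t = λ i s x e → FormalTerm.term a c s x (con (Vec.lookup halfSum i)) e (Vec.lookup ρ i)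
    in Formal.dot σ (zipWith _:-_ (x₁ ∷ x₂ ∷ x₃ ∷ x₄ ∷ x₅ ∷ []) (Formal.point a c (e₁ ∷ e₂ ∷ e₃ ∷ e₄ ∷ e₅ ∷ [])))
      := t (# 0) s₁ x₁ e₁ :+ (t (# 1) s₂ x₂ e₂ :+ (t (# 2) s₃ x₃ e₃ :+ (t (# 3) s₄ x₄ e₄ :+ (t (# 4) s₅ x₅ e₅ :+ con 0ℤ)))))
    refl a c (sign s₁) (sign s₂) (sign s₃) (sign s₄) (sign s₅) x₁ x₂ x₃ x₄ x₅ e₁ e₂ e₃ e₄ e₅

nonneg-* : ∀ n {i} → 0ℤ ≤ᶻ i → 0ℤ ≤ᶻ + n * i
nonneg-* n {+ k} _ = subst (0ℤ ≤ᶻ_) (ℤₚ.pos-* n k) (+≤+ z≤n)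

-- The signs are opposite to the row coefficients e or e + ½, so that subtracting the lattice point
-- raises the pairing. At e = 0 the even case takes ⊕, which keeps x.
evenSign oddSign : ℤ → Sign
evenSign (+ zero)  = ⊕
evenSign (+ suc n) = ⊖
evenSign -[1+ n ]  = ⊕
oddSign (+ n)    = ⊖
oddSign -[1+ n ] = ⊕

module _ (a : ℤ) where

  -- With σ opposite to e, the row adds ∣e∣ copies of 2a + σ r, each at least 2x ≥ 0. If σ is ⊖, one
  -- copy turns -x into x.
  even-term : ∀ e x h r → 0ℤ ≤ᶻ x → x + x ≤ᶻ a + a + sgn (evenSign e) r →
    x ≤ᶻ term a 0ℤ (sign (evenSign e)) x h e r
  even-term (+ zero) x h r 0≤x room = ℤₚ.≤-reflexive
    (solve 4 (λ a x h r → x := FormalTerm.term a (con 0ℤ) (con 1ℤ) x h (con 0ℤ) r) refl a x h r)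
  even-term (+ suc n) x h r 0≤x room =
    ≤-from (ℤₚ.+-mono-≤ room (nonneg-* n (ℤₚ.≤-trans (ℤₚ.+-mono-≤ 0≤x 0≤x) room)))
      (solve 5 (λ a x h n r → ((a :+ a :- r) :+ n :* (a :+ a :- r)) :- ((x :+ x) :+ con 0ℤ)
          := FormalTerm.term a (con 0ℤ) (con -1ℤ) x h (con 1ℤ :+ n) r :- x) refl a x h (+ n) r)
  even-term -[1+ n ] x h r 0≤x room =
    ≤-from (nonneg-* (suc n) (ℤₚ.≤-trans (ℤₚ.+-mono-≤ 0≤x 0≤x) room))
      (solve 5 (λ a x h n r → n :* (a :+ a :+ r) :- con 0ℤ
          := FormalTerm.term a (con 0ℤ) (con 1ℤ) x h (:- n) r :- x) refl a x h (+ suc n) r)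

  -- The bound is met at e = 0 and, by x ≥ -x, at e = -1; further copies of the row add nonnegative
  -- amounts.
  odd-term : ∀ e x h r → 0ℤ ≤ᶻ x → x + x ≤ᶻ a + a + sgn (oddSign e) r →
    a + surplus (oddSign e) h r - x ≤ᶻ term a 1ℤ (sign (oddSign e)) x h e r
  odd-term (+ n) x h r 0≤x room =
    ≤-from (nonneg-* n (ℤₚ.≤-trans (ℤₚ.+-mono-≤ 0≤x 0≤x) room))
      (solve 5 (λ a x h n r → n :* (a :+ a :- r) :- con 0ℤ
          := FormalTerm.term a (con 1ℤ) (con -1ℤ) x h n r :- (a :+ h :- x)) refl a x h (+ n) r)
  odd-term -[1+ n ] x h r 0≤x room =
    ≤-from (ℤₚ.+-mono-≤ (ℤₚ.+-mono-≤ 0≤x 0≤x) (nonneg-* n (ℤₚ.≤-trans (ℤₚ.+-mono-≤ 0≤x 0≤x) room)))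
      (solve 5 (λ a x h n r → ((x :+ x) :+ n :* (a :+ a :+ r)) :- con 0ℤ
          := FormalTerm.term a (con 1ℤ) (con 1ℤ) x h (:- (con 1ℤ :+ n)) r :- (a :+ (r :- h) :- x)) refl a x h (+ n) r)

  Room : ∀ {n} → Vec Sign n → Vec ℤ n → Vec ℤ n → Set
  Room [] [] [] = ⊤
  Room (s ∷ ss) (x ∷ xs) (r ∷ rs) = 0ℤ ≤ᶻ x × x + x ≤ᶻ a + a + sgn s r × Room ss xs rs

  room : ∀ {n} {xs ls : Vec ℤ n} ss rs → Pointwise (λ x l → 0ℤ ≤ᶻ x × x + x ≤ᶻ a + a + l) xs ls →
    Pointwise _≤ᶻ_ ls (zipWith sgn ss rs) → Room ss xs rs
  room []       []       []             []       = tt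
  room (s ∷ ss) (r ∷ rs) ((p , q) ∷ ps) (l ∷ ls) = p , ℤₚ.≤-trans q (ℤₚ.+-monoʳ-≤ (a + a) l) , room ss rs ps ls

  even-terms : ∀ {n} (xs hs es rs : Vec ℤ n) → Room (map evenSign es) xs rs →
    sumᶻ xs ≤ᶻ terms a 0ℤ (map evenSign es) xs hs es rs
  even-terms [] [] [] [] _ = ℤₚ.≤-refl
  even-terms (x ∷ xs) (h ∷ hs) (e ∷ es) (r ∷ rs) (p , q , ps) =
    ℤₚ.+-mono-≤ (even-term e x h r p q) (even-terms xs hs es rs ps)

  odd-terms : ∀ {n} (xs hs es rs : Vec ℤ n) → let ss = map oddSign es in Room ss xs rs →
    + n * a + sumᶻ (zipWith (λ f r → f r) (zipWith surplus ss hs) rs) - sumᶻ xs ≤ᶻ terms a 1ℤ ss xs hs es rs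
  odd-terms [] [] [] [] _ = ℤₚ.≤-refl
  odd-terms {suc n} (x ∷ xs) (h ∷ hs) (e ∷ es) (r ∷ rs) (p , q , ps) =
    ℤₚ.≤-trans (ℤₚ.≤-reflexive
      (solve 6 (λ n a u y x z → (con 1ℤ :+ n) :* a :+ (u :+ y) :- (x :+ z) := (a :+ u :- x) :+ (n :* a :+ y :- z)) refl
        (+ n) a (surplus (oddSign e) h r) (sumᶻ (zipWith (λ f r → f r) (zipWith surplus (map oddSign es) hs) rs)) x (sumᶻ xs)))
      (ℤₚ.+-mono-≤ (odd-term e x h r p q) (odd-terms xs hs es rs ps))

-- The entries add up to k and lie near a/2. The extra 1 sits where `rowBound` is 0 instead of -2;
-- for m = 1 the bound on 2x leaves space for it in no other entry.
remote : ℕ → Vec ℤ 5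
remote m = + m ∷ + suc m ∷ + m ∷ + m ∷ + m ∷ []

sum-remote : ∀ m → sumᶻ (remote m) ≡ + (1 ℕ.+ m ℕ.* 5)
sum-remote m = trans
  (solve 1 (λ m → m :+ ((con 1ℤ :+ m) :+ (m :+ (m :+ (m :+ con 0ℤ)))) := con 1ℤ :+ m :* con (+ 5)) refl (+ m))
  (cong (_+_ 1ℤ) (sym (ℤₚ.pos-* m 5)))

remote-room : ∀ {m} → 1 ≤ m → ∀ ss → Room (+ (2 ℕ.* m)) ss (remote m) (signedRows ss)
remote-room {m} 1≤m ss = room _ ss (signedRows ss)
  (subst (λ a → Pointwise (λ x l → 0ℤ ≤ᶻ x × x + x ≤ᶻ a + a + l) (remote m) rowBound) (sym (ℤₚ.pos-* 2 m))
    (ordinary ∷ (+≤+ z≤n , ≤-from 2≤m+m (solve 1 (λ m → (m :+ m) :- con (+ 2)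
        := (con (+ 2) :* m :+ con (+ 2) :* m :+ con 0ℤ) :- ((con 1ℤ :+ m) :+ (con 1ℤ :+ m))) refl (+ m)))
      ∷ ordinary ∷ ordinary ∷ ordinary ∷ []))
  (proj₁ (signCheck ss))
  where
  2≤m+m : + 2 ≤ᶻ + m + + m
  2≤m+m = +≤+ (ℕₚ.+-mono-≤ 1≤m 1≤m)
  ordinary : 0ℤ ≤ᶻ + m × + m + + m ≤ᶻ + 2 * + m + + 2 * + m + - + 2
  ordinary = +≤+ z≤n , ≤-from 2≤m+m (solve 1 (λ m → (m :+ m) :- con (+ 2)
    := (con (+ 2) :* m :+ con (+ 2) :* m :+ con (- + 2)) :- (m :+ m)) refl (+ m))

remote-even : ∀ {m} → 1 ≤ m → ∀ e → 1 ℕ.+ m ℕ.* 5 ≤ norm (remote m ⊝ point (+ (2 ℕ.* m)) 0ℤ e)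
remote-even {m} 1≤m e = drop‿+≤+ (begin
  + (1 ℕ.+ m ℕ.* 5)                                  ≡⟨ sum-remote m ⟨
  sumᶻ (remote m)                                    ≤⟨ even-terms a (remote m) halfSum e (signedRows ss) (remote-room 1≤m ss) ⟩
  terms a 0ℤ ss (remote m) halfSum e (signedRows ss) ≡⟨ dot-signs-point a 0ℤ ss (remote m) e ⟨
  dot (map sign ss) (remote m ⊝ point a 0ℤ e)        ≤⟨ dot-signs≤norm ss _ ⟩
  + norm (remote m ⊝ point a 0ℤ e)                   ∎)
  where
  open ℤₚ.≤-Reasoning
  a  = + (2 ℕ.* m)
  ss = map evenSign e

remote-odd : ∀ {m} → 1 ≤ m → ∀ e → 1 ℕ.+ m ℕ.* 5 ≤ norm (remote m ⊝ point (+ (2 ℕ.* m)) 1ℤ e)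
remote-odd {m} 1≤m e = drop‿+≤+ (begin
  + (1 ℕ.+ m ℕ.* 5)                                  ≡⟨ cong (_+_ 1ℤ) (ℤₚ.pos-* m 5) ⟩
  -- Since 5a = 2k - 2, the two sides differ by S - 2, and `signCheck` gives S ≥ 3.
  1ℤ + + m * + 5                                     ≤⟨ ≤-from (ℤₚ.≤-trans (+≤+ (s≤s (s≤s z≤n))) (proj₂ (signCheck ss)))
    (solve 2 (λ m s → s :- con (+ 2) := (con (+ 5) :* (con (+ 2) :* m) :+ s :- (con 1ℤ :+ m :* con (+ 5))) :- (con 1ℤ :+ m :* con (+ 5))) refl (+ m) S) ⟩
  + 5 * (+ 2 * + m) + S - (1ℤ + + m * + 5)           ≡⟨ cong₂ (λ a k → + 5 * a + S - k) (ℤₚ.pos-* 2 m) (trans (sum-remote m) (cong (_+_ 1ℤ) (ℤₚ.pos-* m 5))) ⟨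
  + 5 * a + S - sumᶻ (remote m)                      ≤⟨ odd-terms a (remote m) halfSum e (signedRows ss) (remote-room 1≤m ss) ⟩
  terms a 1ℤ ss (remote m) halfSum e (signedRows ss) ≡⟨ dot-signs-point a 1ℤ ss (remote m) e ⟨
  dot (map sign ss) (remote m ⊝ point a 1ℤ e)        ≤⟨ dot-signs≤norm ss _ ⟩
  + norm (remote m ⊝ point a 1ℤ e)                   ∎)
  where
  open ℤₚ.≤-Reasoning
  a  = + (2 ℕ.* m)
  ss = map oddSign e
  S  = sumᶻ (zipWith (λ f r → f r) (zipWith surplus ss halfSum) (signedRows ss))

-- The diameter for m ≥ 1, and the polynomials in k

evalℕ : List ℤ → ℕ → ℕ
evalℕ = Linear.eval ∣_∣ ℕ._+_ ℕ._*_

evalℕ-pos : ∀ cs z → + evalℕ (poly cs) z ≡ eval (poly cs) (+ z)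
evalℕ-pos []       z = refl
evalℕ-pos (c ∷ cs) z = cong (_+_ (+ c)) (trans (ℤₚ.pos-* z _) (cong (_*_ (+ z)) (evalℕ-pos cs z)))

diameter : ∀ m → 1 ≤ m →
  HasDiameter (evalℕ (poly order) (2 ℕ.* m)) (Vec.toList (weights (+ (2 ℕ.* m)))) (1 ℕ.+ m ℕ.* 5)
diameter m 1≤m = upper , Fin.zero , target , lower
  where
  open ≡-Reasoning
  n = evalℕ (poly order) (2 ℕ.* m)
  a = + (2 ℕ.* m)
  W = weights a

  dot-first : ∀ d → dot W (d ∷ replicate 4 0ℤ) ≡ d
  dot-first d = trans (cong (_+_ ((1ℤ + a * 0ℤ) * d)) (dot-zero (tail W)))
    (solve 2 (λ a d → (con 1ℤ :+ a :* con 0ℤ) :* d :+ con 0ℤ := d) refl a d)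

  upper : ∀ i j → DistLe n (Vec.toList W) i j (1 ℕ.+ m ℕ.* 5)
  upper i j =
    let d = + toℕ j - + toℕ i
        -- The first generator is 1, so (d, 0, 0, 0, 0) represents the difference d; `cover`
        -- shortens it modulo the order.
        ys , norm≤ , r , eq = cover m 1≤m (d ∷ replicate 4 0ℤ) (<-wellFounded _)
        steps , len , all , sum = vector⇒steps W ys
    in norm ys , norm≤ , steps , len , all , ∣⇒∣ᵤ (divides r (begin
      d - sumℤ steps                              ≡⟨ cong₂ _-_ (trans (sym (dot-first d)) eq) sum ⟩
      dot W ys + r * eval (poly order) a - dot W ys
        ≡⟨ solve 2 (λ y z → y :+ z :- y := z) refl (dot W ys) (r * eval (poly order) a) ⟩
      r * eval (poly order) a                     ≡⟨ cong (_*_ r) (evalℕ-pos order (2 ℕ.* m)) ⟨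
      r * + n                                     ∎))

  p = dot W (remote m)

  target : Fin n
  target = fromℕ< (n%ℕd<d p n)

  lower : ∀ ℓ → ℓ < 1 ℕ.+ m ℕ.* 5 → ¬ Walk n (Vec.toList W) Fin.zero target ℓ
  lower ℓ ℓ<k (steps , len , all , n∣) with ∣ᵤ⇒∣ {+ n} {+ toℕ target - 0ℤ - sumℤ steps} n∣ | steps⇒vector W all
  ... | divides q eq | xs , norm≤ , sum =
    -- `remote m` and `xs` have equal residues, so their difference is a lattice point. Subtracting
    -- it from `remote m` leaves `xs`, whose norm is therefore at least k.
    let e , cases = relation-point a (q + p /ℕ n) (remote m ⊝ xs) (begin
          dot W (remote m ⊝ xs)          ≡⟨ dot-⊝ W (remote m) xs ⟩
          p - dot W xs                   ≡⟨ cong₂ _-_ (a≡a%ℕn+[a/ℕn]*n p n) sum ⟩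
          + (p %ℕ n) + (p /ℕ n) * + n - sumℤ steps
            ≡⟨ cong (λ t → + t + (p /ℕ n) * + n - sumℤ steps) (toℕ-fromℕ< (n%ℕd<d p n)) ⟨
          + toℕ target + (p /ℕ n) * + n - sumℤ steps
            ≡⟨ solve 3 (λ t z s → t :+ z :- s := (t :- con 0ℤ :- s) :+ z) refl (+ toℕ target) ((p /ℕ n) * + n) (sumℤ steps) ⟩
          (+ toℕ target - 0ℤ - sumℤ steps) + (p /ℕ n) * + n
            ≡⟨ cong (_+ (p /ℕ n) * + n) eq ⟩
          q * + n + (p /ℕ n) * + n       ≡⟨ ℤₚ.*-distribʳ-+ (+ n) q (p /ℕ n) ⟨
          (q + p /ℕ n) * + n             ≡⟨ cong (_*_ (q + p /ℕ n)) (evalℕ-pos order (2 ℕ.* m)) ⟩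
          (q + p /ℕ n) * eval (poly order) a ∎)
    in ℕₚ.<⇒≱ ℓ<k (ℕₚ.≤-trans ([ far 0ℤ e (remote-even 1≤m e) , far 1ℤ e (remote-odd 1≤m e) ]′ cases)
         (ℕₚ.≤-trans norm≤ (ℕₚ.≤-reflexive len)))
    where
    far : ∀ c e → 1 ℕ.+ m ℕ.* 5 ≤ norm (remote m ⊝ point a c e) → remote m ⊝ xs ≡ point a c e → 1 ℕ.+ m ℕ.* 5 ≤ norm xs
    far c e bound eq = subst (λ v → 1 ℕ.+ m ℕ.* 5 ≤ norm v) (sym (trans (⊝-⊝ (remote m) xs) (cong (remote m ⊝_) eq))) bound

-- The coefficients are variables, since numerals would be unfolded in unary.
quartic : ∀ c₄ c₃ c₂ c₁ c₀ k →
  c₄ ℕ.* k ℕ.^ 4 ℕ.+ c₃ ℕ.* k ℕ.^ 3 ℕ.+ c₂ ℕ.* k ℕ.^ 2 ℕ.+ c₁ ℕ.* k ℕ.+ c₀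
    ≡ c₀ ℕ.+ k ℕ.* (c₁ ℕ.+ k ℕ.* (c₂ ℕ.+ k ℕ.* (c₃ ℕ.+ k ℕ.* (c₄ ℕ.+ k ℕ.* 0))))
quartic = unfolded
  where
  unfolded : ∀ c₄ c₃ c₂ c₁ c₀ k →
    c₄ ℕ.* (k ℕ.* (k ℕ.* (k ℕ.* (k ℕ.* 1)))) ℕ.+ c₃ ℕ.* (k ℕ.* (k ℕ.* (k ℕ.* 1))) ℕ.+ c₂ ℕ.* (k ℕ.* (k ℕ.* 1)) ℕ.+ c₁ ℕ.* k ℕ.+ c₀
      ≡ c₀ ℕ.+ k ℕ.* (c₁ ℕ.+ k ℕ.* (c₂ ℕ.+ k ℕ.* (c₃ ℕ.+ k ℕ.* (c₄ ℕ.+ k ℕ.* 0))))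
  unfolded = ℕ-ring

quintic : ∀ c₅ c₄ c₃ c₂ c₁ c₀ k →
  c₅ ℕ.* k ℕ.^ 5 ℕ.+ c₄ ℕ.* k ℕ.^ 4 ℕ.+ c₃ ℕ.* k ℕ.^ 3 ℕ.+ c₂ ℕ.* k ℕ.^ 2 ℕ.+ c₁ ℕ.* k ℕ.+ c₀
    ≡ c₀ ℕ.+ k ℕ.* (c₁ ℕ.+ k ℕ.* (c₂ ℕ.+ k ℕ.* (c₃ ℕ.+ k ℕ.* (c₄ ℕ.+ k ℕ.* (c₅ ℕ.+ k ℕ.* 0)))))
quintic = unfolded
  where
  unfolded : ∀ c₅ c₄ c₃ c₂ c₁ c₀ k →
    c₅ ℕ.* (k ℕ.* (k ℕ.* (k ℕ.* (k ℕ.* (k ℕ.* 1))))) ℕ.+ c₄ ℕ.* (k ℕ.* (k ℕ.* (k ℕ.* (k ℕ.* 1))))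
      ℕ.+ c₃ ℕ.* (k ℕ.* (k ℕ.* (k ℕ.* 1))) ℕ.+ c₂ ℕ.* (k ℕ.* (k ℕ.* 1)) ℕ.+ c₁ ℕ.* k ℕ.+ c₀
      ≡ c₀ ℕ.+ k ℕ.* (c₁ ℕ.+ k ℕ.* (c₂ ℕ.+ k ℕ.* (c₃ ℕ.+ k ℕ.* (c₄ ℕ.+ k ℕ.* (c₅ ℕ.+ k ℕ.* 0)))))
  unfolded = ℕ-ring

Scaled : List ℕ → List ℕ → ℕ → Set
Scaled cs ds d = ∀ m → eval (poly cs) (1ℤ + m * + 5) ≡ eval (poly ds) (+ 2 * m) * + d

:scaled : List ℕ → List ℕ → ℕ → Polynomial 1 → _
:scaled cs ds d m = Formal.eval (poly cs) (con 1ℤ :+ m :* con (+ 5)) := Formal.eval (poly ds) (con (+ 2) :* m) :* con (+ d)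

-- Substituting k = 1 + 5m and a = 2m turns the numerator into d times a polynomial in a with
-- natural coefficients, so the division is exact.
quotient : ∀ cs ds d .{{_ : NonZero d}} → Scaled cs ds d → ∀ m {x} →
  x ≡ evalℕ (poly cs) (1 ℕ.+ m ℕ.* 5) → x ℕ./ d ≡ evalℕ (poly ds) (2 ℕ.* m)
quotient cs ds d scaled m {x} eq = trans (cong (ℕ._/ d) (ℤₚ.+-injective (begin
  + x                                            ≡⟨ cong +_ eq ⟩
  + evalℕ (poly cs) (1 ℕ.+ m ℕ.* 5)              ≡⟨ evalℕ-pos cs _ ⟩
  eval (poly cs) (1ℤ + + (m ℕ.* 5))              ≡⟨ cong (λ z → eval (poly cs) (1ℤ + z)) (ℤₚ.pos-* m 5) ⟩
  eval (poly cs) (1ℤ + + m * + 5)                ≡⟨ scaled (+ m) ⟩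
  eval (poly ds) (+ 2 * + m) * + d               ≡⟨ cong (λ z → eval (poly ds) z * + d) (ℤₚ.pos-* 2 m) ⟨
  eval (poly ds) (+ (2 ℕ.* m)) * + d             ≡⟨ cong (_* + d) (evalℕ-pos ds _) ⟨
  + evalℕ (poly ds) (2 ℕ.* m) * + d              ≡⟨ ℤₚ.pos-* (evalℕ (poly ds) (2 ℕ.* m)) d ⟨
  + (evalℕ (poly ds) (2 ℕ.* m) ℕ.* d)            ∎))) (m*n/n≡m (evalℕ (poly ds) (2 ℕ.* m)) d)
  where open ≡-Reasoning

Lcc10≡ : ∀ m → Lcc10 (1 ℕ.+ m ℕ.* 5) ≡ evalℕ (poly order) (2 ℕ.* m)
Lcc10≡ m = quotient cs order 3125 (solve 1 (:scaled cs order 3125) refl) m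
  (quintic 512 1280 6560 9520 6100 1028 (1 ℕ.+ m ℕ.* 5))
  where cs = 1028 ∷ 6100 ∷ 9520 ∷ 6560 ∷ 1280 ∷ 512 ∷ []

gens10≡ : ∀ m → gens10 (1 ℕ.+ m ℕ.* 5) ≡ Vec.toList (weights (+ (2 ℕ.* m)))
gens10≡ m =
  cong₂ _∷_ (solve 1 (λ a → con 1ℤ := con 1ℤ :+ a :* con 0ℤ) refl (+ (2 ℕ.* m)))
  (cong₂ _∷_ (generator 128 448 1688 3768 843 (# 1)
    (solve 1 (:scaled (843 ∷ 3768 ∷ 1688 ∷ 448 ∷ 128 ∷ []) (Vec.lookup generators (# 1)) 625) refl))
  (cong₂ _∷_ (generator 256 416 2816 2346 416 (# 2)
    (solve 1 (:scaled (416 ∷ 2346 ∷ 2816 ∷ 416 ∷ 256 ∷ []) (Vec.lookup generators (# 2)) 625) refl))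
  (cong₂ _∷_ (generator 256 576 3136 3976 1431 (# 3)
    (solve 1 (:scaled (1431 ∷ 3976 ∷ 3136 ∷ 576 ∷ 256 ∷ []) (Vec.lookup generators (# 3)) 625) refl))
  (cong₂ _∷_ (generator 384 864 4504 5614 1134 (# 4)
    (solve 1 (:scaled (1134 ∷ 5614 ∷ 4504 ∷ 864 ∷ 384 ∷ []) (Vec.lookup generators (# 4)) 625) refl)) refl))))
  where
  k = 1 ℕ.+ m ℕ.* 5
  generator : ∀ c₄ c₃ c₂ c₁ c₀ i → let g = Vec.lookup generators i in
    Scaled (c₀ ∷ c₁ ∷ c₂ ∷ c₃ ∷ c₄ ∷ []) g 625 →
    + ((c₄ ℕ.* k ℕ.^ 4 ℕ.+ c₃ ℕ.* k ℕ.^ 3 ℕ.+ c₂ ℕ.* k ℕ.^ 2 ℕ.+ c₁ ℕ.* k ℕ.+ c₀) ℕ./ 625) ≡ eval (poly g) (+ (2 ℕ.* m))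
  generator c₄ c₃ c₂ c₁ c₀ i scaled =
    trans (cong +_ (quotient (c₀ ∷ c₁ ∷ c₂ ∷ c₃ ∷ c₄ ∷ []) g 625 scaled m (quartic c₄ c₃ c₂ c₁ c₀ k))) (evalℕ-pos g (2 ℕ.* m))
    where g = Vec.lookup generators i

-- The case k = 1

diameter-one : HasDiameter (Lcc10 1) (gens10 1) 1
diameter-one = upper , # 0 , # 1 , lower
  where
  gs = + 1 ∷ + 11 ∷ + 10 ∷ + 15 ∷ + 20 ∷ []

  -- Modulo 8 the generators are 1, 3, 2, -1, 4, so ±1, ±3, ±2 and 4 give every nonzero residue.
  units : List (Vec ℤ 5)
  units = (0ℤ ∷ 0ℤ ∷ 0ℤ ∷ 0ℤ ∷ 0ℤ ∷ [])
    ∷ (1ℤ ∷ 0ℤ ∷ 0ℤ ∷ 0ℤ ∷ 0ℤ ∷ []) ∷ (-1ℤ ∷ 0ℤ ∷ 0ℤ ∷ 0ℤ ∷ 0ℤ ∷ [])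
    ∷ (0ℤ ∷ 1ℤ ∷ 0ℤ ∷ 0ℤ ∷ 0ℤ ∷ []) ∷ (0ℤ ∷ -1ℤ ∷ 0ℤ ∷ 0ℤ ∷ 0ℤ ∷ [])
    ∷ (0ℤ ∷ 0ℤ ∷ 1ℤ ∷ 0ℤ ∷ 0ℤ ∷ []) ∷ (0ℤ ∷ 0ℤ ∷ -1ℤ ∷ 0ℤ ∷ 0ℤ ∷ [])
    ∷ (0ℤ ∷ 0ℤ ∷ 0ℤ ∷ 0ℤ ∷ 1ℤ ∷ []) ∷ []

  Reaches : Fin 8 → Fin 8 → Vec ℤ 5 → Set
  Reaches i j x = norm x ≤ 1 × + 8 ∣ℤ (+ toℕ j - + toℕ i - dot gs x)

  reaches : ∀ i j → Any (Reaches i j) units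
  reaches = from-does (all? λ i → all? λ j → Any.any? (λ x → (norm x ℕ.≤? 1) ×-dec (8 ∣? _)) units) refl

  upper : ∀ i j → DistLe 8 (Vec.toList gs) i j 1
  upper i j =
    let x , norm≤ , 8∣ = Any.satisfied (reaches i j)
        steps , len , all , sum = vector⇒steps gs x
    in norm x , norm≤ , steps , len , all , subst (λ s → + 8 ∣ℤ (+ toℕ j - + toℕ i - s)) (sym sum) 8∣

  lower : ∀ ℓ → ℓ < 1 → ¬ Walk 8 (Vec.toList gs) (# 0) (# 1) ℓ
  lower zero    _        ([] , _ , _ , 8∣1) = from-no (8 ∣? 1) 8∣1
  lower (suc _) (s≤s ())

theorem4 : (k : ℕ) → 1 ≤ k → k % 5 ≡ 1 →
    HasDiameter (Lcc10 k) (gens10 k) k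
theorem4 k 1≤k k%5≡1 = subst (λ k → HasDiameter (Lcc10 k) (gens10 k) k) (sym k≡) (go (k ℕ./ 5))
  where
  k≡ : k ≡ 1 ℕ.+ (k ℕ./ 5) ℕ.* 5
  k≡ = trans (m≡m%n+[m/n]*n k 5) (cong (ℕ._+ (k ℕ./ 5) ℕ.* 5) k%5≡1)
  go : ∀ m → HasDiameter (Lcc10 (1 ℕ.+ m ℕ.* 5)) (gens10 (1 ℕ.+ m ℕ.* 5)) (1 ℕ.+ m ℕ.* 5)
  go zero    = diameter-one
  go (suc m) = subst₂ (λ n gs → HasDiameter n gs (1 ℕ.+ suc m ℕ.* 5))
    (sym (Lcc10≡ (suc m))) (sym (gens10≡ (suc m))) (diameter (suc m) (s≤s z≤n))
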